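{- In the Strong Ramsey game $\mathcal{R}(K_{\aleph_0}, \hat{K}_{2,3})$, the first player $P_1$ has a winning strategy.
   Context: For $k$-uniform hypergraphs $B$ (the board, possibly infinite) and $G$ (the target graph, finite), the Strong Ramsey game $\mathcal{R}(B,G)$ is played by two players $P_1$ and $P_2$ who alternately claim (color in their own color) previously unclaimed edges of $B$, with $P_1$ moving first. The first player to claim all edges of a copy of $G$ in their own color wins; if neither player does so within finitely many moves, the game is a draw. Here $K_{\aleph_0}$ is the complete graph on a countably infinite vertex set. For $t \in \mathbb{N}$, $\hat{K}_{2,t}$ denotes the complete bipartite graph $K_{2,t}$ together with the edge joining the two vertices of the part of size $2$. -}

module Defs where

open import Data.Nat using (ℕ; zero; suc; _+_)
open import Data.Fin using (Fin; toℕ) renaming (zero to fzero; suc to fsuc)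
open import Data.Product using (Σ; _×_; _,_)
open import Data.Sum using (_⊎_)
open import Data.List using (List; []; _∷_; _++_; [_]; map; allFin; concatMap)
open import Data.List.Membership.Propositional using (_∈_)
open import Data.List.Relation.Unary.All using (All)
open import Relation.Binary.PropositionalEquality using (_≡_)
open import Relation.Nullary using (¬_)
open import Function.Definitions using (Injective)

-- The board K_{ℵ₀}: vertex set ℕ.  A (move naming an) edge is a pair of
-- naturals; the pair (a , b) names the unordered edge {a , b}.
Edge : Set
Edge = ℕ × ℕ

Claimed : List Edge → ℕ → ℕ → Set
Claimed S a b = ((a , b) ∈ S) ⊎ ((b , a) ∈ S)

Legal : List Edge → Edge → Set
Legal h (a , b) = (¬ a ≡ b) × ¬ Claimed h a b

mutual
  evens : List Edge → List Edge
  evens []       = []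
  evens (x ∷ xs) = x ∷ odds xs

  odds : List Edge → List Edge
  odds []       = []
  odds (x ∷ xs) = evens xs

P1edges P2edges : List Edge → List Edge
P1edges = evens
P2edges = odds

record Graph : Set where
  field
    n     : ℕ
    edges : List (Fin n × Fin n)
open Graph public

ContainsCopy : List Edge → Graph → Set
ContainsCopy S G =
  Σ (Fin (n G) → ℕ) λ f →
    Injective _≡_ _≡_ f × All (λ { (u , v) → Claimed S (f u) (f v) }) (edges G)

-- K̂_{2,t}: vertices 0,1 form the part of size 2, vertices 2,…,t+1 the part
-- of size t; edges {0,1} and {i , 2+j} for i ∈ {0,1}, j < t.
K̂2 : (t : ℕ) → Graph
K̂2 t = record
  { n = 2 + t
  ; edges = (v0 , v1) ∷ concatMap (λ j → (v0 , big j) ∷ (v1 , big j) ∷ []) (allFin t)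
  }
  where
  v0 v1 : Fin (2 + t)
  v0 = fzero
  v1 = fsuc fzero
  big : Fin t → Fin (2 + t)
  big j = fsuc (fsuc j)

Strategy : Set
Strategy = List Edge → Edge

LegalStrategy : Strategy → Set
LegalStrategy σ = ∀ h → Legal h (σ h)

history : Strategy → Strategy → ℕ → List Edge
history σ τ zero = []
history σ τ (suc k) =
  let h  = history σ τ k
      h′ = h ++ [ σ h ]
  in  h′ ++ [ τ h′ ]

P1Wins : Graph → Strategy → Strategy → Set
P1Wins G σ τ =
  Σ ℕ λ k →
    let h = history σ τ k in
    ContainsCopy (P1edges (h ++ [ σ h ])) G × ¬ ContainsCopy (P2edges h) G

P1HasWinningStrategy : Graph → Set
P1HasWinningStrategy G =
  Σ Strategy λ σ → LegalStrategy σ × (∀ τ → LegalStrategy τ → P1Wins G σ τ)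

{-# OPTIONS --safe #-}
module Submission where

-- A book is a copy of K̂_{2,3}: a base edge u a with three pages x, each joined to u and to a; with two
-- pages it is a diamond, with one a triangle. Suppose the first player is to move with a diamond on the base
-- u a and pages b, c, and the second player cannot complete a book with one more edge. Claiming u d for a
-- fresh d threatens a book, so the answer a d is forced, and it is useless to the second player unless his
-- own edges contain a diamond based at a; with at most six edges he cannot have diamonds based at a and
-- at u both. After three such rounds, with d, e and f, claiming b d and then b e or b f completes a book on
-- the base u b.
-- So the first player only has to reach a diamond within six moves while the second player is at least two
-- moves short of a book. A book has seven edges, so the second player only keeps pace if his edges all
-- lie in one common book, which leaves finitely many openings up to renaming of his new vertices. A finite
-- plan for the opening, a star followed by edges between its leaves, is verified by computation.

open import Defs
open import Data.Bool using (Bool; true; false; T; _∧_; _∨_)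
open import Data.Bool.ListAction using (all)
open import Data.Bool.Properties using (T-∧; T-∨; T-≡)
open import Data.Empty using (⊥)
open import Data.Fin using () renaming (zero to fzero; suc to fsuc)
open import Data.Fin.Properties using () renaming (_≟_ to _≟ᶠ_)
open import Data.List using (List; []; _∷_; _++_; [_]; length; lookup; filter; map; concatMap; deduplicate; allFin)
open import Data.List.Membership.Propositional using (_∈_; _∉_; find)
open import Data.List.Membership.Propositional.Properties
  using (∈-lookup; ∈-map⁺; ∈-filter⁺; ∈-deduplicate⁺; ∈-deduplicate⁻; ∈-concatMap⁺; ∈-concatMap⁻)
open import Data.List.Properties using (length-++; ++-assoc; ++-identityʳ)
open import Data.List.Relation.Binary.Permutation.Propositional using (_↭_; ↭-refl; ↭-trans; ↭-sym; ↭-reflexive)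
open import Data.List.Relation.Binary.Permutation.Propositional.Properties using (Any-resp-↭; shift)
open import Data.List.Relation.Unary.All as All using (All; []; _∷_; all?)
open import Data.List.Relation.Unary.All.Properties using (¬Any⇒All¬; ++⁻ʳ; all⁺)
open import Data.List.Relation.Unary.AllPairs as AllPairs using (AllPairs; []; _∷_)
open import Data.List.Relation.Unary.Any as Any using (Any; here; there; any?)
open import Data.List.Relation.Unary.Any.Properties using (++⁺ˡ; ++⁺ʳ; ++⁻)
open import Data.List.Relation.Unary.Unique.Propositional using (Unique)
open import Data.List.Relation.Unary.Unique.Propositional.Properties using () renaming (map⁺ to Unique-map⁺)
open import Data.List.Relation.Unary.Unique.DecPropositional using (unique?)
open import Data.List.Relation.Unary.Unique.DecPropositional.Properties using (deduplicate-!)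
open import Data.Nat using (ℕ; suc; _+_; _≤_; _≤?_; z≤n; s≤s; s≤s⁻¹)
open import Data.Nat.Properties
open import Data.List.Membership.DecPropositional _≟_ using (_∈?_)
open import Data.Product using (Σ; ∃; _×_; _,_; proj₁; proj₂; swap) renaming (map to ×-map)
open import Data.Sum using (_⊎_; inj₁; inj₂; [_,_]′) renaming (map to ⊎-map)
open import Function using (_∘_; id)
open import Function.Bundles using (Equivalence)
open import Relation.Binary.PropositionalEquality using (_≡_; _≢_; refl; sym; trans; cong; cong₂; subst; ≢-sym)
open import Relation.Nullary using (¬_; Dec; yes; no; contradiction)
open import Relation.Nullary.Decidable using (_×-dec_; _⊎-dec_; ¬?; ⌊_⌋; toWitness; from-yes)
open import Relation.Unary using (Decidable)

-- Unordered edges.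

Same : Edge → Edge → Set
Same (a , b) (c , d) = (a ≡ c × b ≡ d) ⊎ (a ≡ d × b ≡ c)

Same-refl : ∀ {e} → Same e e
Same-refl = inj₁ (refl , refl)

Same-sym : ∀ {e f} → Same e f → Same f e
Same-sym (inj₁ (refl , refl)) = inj₁ (refl , refl)
Same-sym (inj₂ (refl , refl)) = inj₂ (refl , refl)

Same-trans : ∀ {e f g} → Same e f → Same f g → Same e g
Same-trans (inj₁ (refl , refl)) s = s
Same-trans (inj₂ (refl , refl)) (inj₁ (refl , refl)) = inj₂ (refl , refl)
Same-trans (inj₂ (refl , refl)) (inj₂ (refl , refl)) = inj₁ (refl , refl)

Same-flip : ∀ {a b} → Same (a , b) (b , a)
Same-flip = inj₂ (refl , refl)

Same-pivot : ∀ {x y d e} → Same (x , d) e → Same (y , d) e → x ≡ y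
Same-pivot s t with Same-trans s (Same-sym t)
... | inj₁ (x≡y , _) = x≡y
... | inj₂ (x≡d , d≡y) = trans x≡d d≡y

Same-pivot′ : ∀ {x y d e} → Same (d , x) e → Same (d , y) e → x ≡ y
Same-pivot′ s t = Same-pivot (Same-trans Same-flip s) (Same-trans Same-flip t)

same? : ∀ e f → Dec (Same e f)
same? (a , b) (c , d) = (a ≟ c ×-dec b ≟ d) ⊎-dec (a ≟ d ×-dec b ≟ c)

infix 4 _∈ᵤ_ _∉ᵤ_

_∈ᵤ_ _∉ᵤ_ : Edge → List Edge → Set
e ∈ᵤ S = Any (Same e) S
e ∉ᵤ S = ¬ e ∈ᵤ S

_∈ᵤ?_ : ∀ e S → Dec (e ∈ᵤ S)
e ∈ᵤ? S = any? (same? e) S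

∈ᵤ-resp : ∀ {e f S} → Same e f → e ∈ᵤ S → f ∈ᵤ S
∈ᵤ-resp s = Any.map (Same-trans (Same-sym s))

∈ᵤ-flip : ∀ {a b S} → (a , b) ∈ᵤ S → (b , a) ∈ᵤ S
∈ᵤ-flip = ∈ᵤ-resp Same-flip

∈⇒∈ᵤ : ∀ {e S} → e ∈ S → e ∈ᵤ S
∈⇒∈ᵤ = Any.map λ { refl → Same-refl }

Claimed⇒∈ᵤ : ∀ {S a b} → Claimed S a b → (a , b) ∈ᵤ S
Claimed⇒∈ᵤ (inj₁ p) = ∈⇒∈ᵤ p
Claimed⇒∈ᵤ (inj₂ p) = ∈ᵤ-flip (∈⇒∈ᵤ p)

∈ᵤ⇒Claimed : ∀ {S a b} → (a , b) ∈ᵤ S → Claimed S a b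
∈ᵤ⇒Claimed (here (inj₁ (refl , refl))) = inj₁ (here refl)
∈ᵤ⇒Claimed (here (inj₂ (refl , refl))) = inj₂ (here refl)
∈ᵤ⇒Claimed (there p) = ⊎-map there there (∈ᵤ⇒Claimed p)

-- Counting distinct elements up to a relation.

module _ {X : Set} (_~_ : X → X → Set) (eucl : ∀ {x y z} → x ~ z → y ~ z → x ~ y) where

  private
    remove : ∀ {x H} → Any (x ~_) H →
      Σ (List X) λ H′ → (length H ≡ suc (length H′)) × (∀ {y} → ¬ x ~ y → Any (y ~_) H → Any (y ~_) H′)
    remove {H = _ ∷ H} (here x~h) = H , refl , λ
      { x≁y (here y~h) → contradiction (eucl x~h y~h) x≁y
      ; _ (there y∈H) → y∈H }
    remove {H = h ∷ _} (there x∈H) with remove x∈H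
    ... | H′ , eq , keep = h ∷ H′ , cong suc eq , λ
      { _ (here y~h) → here y~h
      ; x≁y (there y∈H) → there (keep x≁y y∈H) }

  -- Pigeonhole: each `x` of `L` uses up one entry of `H`. No later element loses its entry, since
  -- by `eucl` two elements that share an entry are related.
  distinct⇒length≤ : ∀ {L H} → AllPairs (λ x y → ¬ x ~ y) L → All (λ x → Any (x ~_) H) L → length L ≤ length H
  distinct⇒length≤ [] _ = z≤n
  distinct⇒length≤ (x≁L ∷ dL) (x∈H ∷ L∈H) with remove x∈H
  ... | H′ , eq , keep = subst (_ ≤_) (sym eq)
    (s≤s (distinct⇒length≤ dL (All.map (λ (x≁y , y∈H) → keep x≁y y∈H) (All.zip (x≁L , L∈H)))))

Distinct : List Edge → Set
Distinct = AllPairs (λ e f → ¬ Same e f)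

distinctEdges⇒length≤ : ∀ {L H} → Distinct L → All (_∈ᵤ H) L → length L ≤ length H
distinctEdges⇒length≤ = distinct⇒length≤ Same λ s t → Same-trans s (Same-sym t)

-- An edge of `H` outside `L` could be put in front of `L`, giving a distinct list that is too long
-- for `H`.
distinctEdges-cover : ∀ {L H} → Distinct L → All (_∈ᵤ H) L → length H ≤ length L → All (_∈ᵤ L) H
distinctEdges-cover {L} {H} dL L∈H H≤L = All.tabulate covered
  where
  covered : ∀ {e} → e ∈ H → e ∈ᵤ L
  covered {e} e∈H with e ∈ᵤ? L
  ... | yes e∈L = e∈L
  ... | no e∉L = contradiction
    (≤-trans (distinctEdges⇒length≤ (¬Any⇒All¬ L e∉L ∷ dL) (∈⇒∈ᵤ e∈H ∷ L∈H)) H≤L) (<-irrefl refl)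

-- Books and diamonds.

spokes : ℕ → ℕ → List ℕ → List Edge
spokes u a [] = []
spokes u a (r ∷ rs) = (u , r) ∷ (a , r) ∷ spokes u a rs

bookEdges : ℕ → ℕ → List ℕ → List Edge
bookEdges u a rs = (u , a) ∷ spokes u a rs

Pages : (Edge → Set) → ℕ → ℕ → List ℕ → Set
Pages P u a rs = Unique (u ∷ a ∷ rs) × All P (bookEdges u a rs)

Pages-map : ∀ {P Q : Edge → Set} {u a rs} → (∀ {e} → P e → Q e) → Pages P u a rs → Pages Q u a rs
Pages-map f (un , es) = un , All.map f es

Book : List Edge → ℕ → ℕ → ℕ → ℕ → ℕ → Set
Book S u a x y z = Pages (_∈ᵤ S) u a (x ∷ y ∷ z ∷ [])

Bookless : List Edge → Set
Bookless S = ∀ {u a x y z} → ¬ Book S u a x y z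

Diamond : List Edge → ℕ → ℕ → ℕ → ℕ → Set
Diamond S u a x y = Pages (_∈ᵤ S) u a (x ∷ y ∷ [])

bookEdges-distinct : ∀ {u a} rs → Unique (u ∷ a ∷ rs) → Distinct (bookEdges u a rs)
bookEdges-distinct {u} {a} rs ((u≢a ∷ u≢rs) ∷ a≢rs ∷ un) = base u≢rs a≢rs ∷ distinct u≢rs a≢rs un
  where
  base : ∀ {rs} → All (u ≢_) rs → All (a ≢_) rs → All (λ f → ¬ Same (u , a) f) (spokes u a rs)
  base [] [] = []
  base (u≢r ∷ us) (a≢r ∷ as) =
    [ a≢r ∘ proj₂ , u≢r ∘ proj₁ ]′ ∷ [ u≢a ∘ proj₁ , u≢r ∘ proj₁ ]′ ∷ base us as
  apart : ∀ {p r rs} → p ≢ r → All (r ≢_) rs → All (u ≢_) rs → All (a ≢_) rs → (p ≡ u ⊎ p ≡ a) →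
    All (λ f → ¬ Same (p , r) f) (spokes u a rs)
  apart _ [] [] [] _ = []
  apart p≢r (r≢s ∷ rs) (u≢s ∷ us) (a≢s ∷ as) p∈ =
    [ r≢s ∘ proj₂ , p≢s p∈ ∘ proj₁ ]′ ∷ [ r≢s ∘ proj₂ , p≢s p∈ ∘ proj₁ ]′ ∷ apart p≢r rs us as p∈
    where
    p≢s : _ → _ ≢ _
    p≢s (inj₁ refl) = u≢s
    p≢s (inj₂ refl) = a≢s
  distinct : ∀ {rs} → All (u ≢_) rs → All (a ≢_) rs → Unique rs → Distinct (spokes u a rs)
  distinct [] [] [] = []
  distinct (u≢r ∷ us) (a≢r ∷ as) (r≢rs ∷ un) =
    ([ u≢a ∘ proj₁ , u≢r ∘ proj₁ ]′ ∷ apart u≢r r≢rs us as (inj₁ refl)) ∷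
    apart a≢r r≢rs us as (inj₂ refl) ∷ distinct us as un

spokes-swap : ∀ {P : Edge → Set} {u a} rs → All P (spokes u a rs) → All P (spokes a u rs)
spokes-swap [] [] = []
spokes-swap (_ ∷ rs) (ur ∷ ar ∷ es) = ar ∷ ur ∷ spokes-swap rs es

swapBase : ∀ {S u a rs} → Pages (_∈ᵤ S) u a rs → Pages (_∈ᵤ S) a u rs
swapBase {rs = rs} (((u≢a ∷ u≢rs) ∷ a≢rs ∷ un) , (ua ∷ es)) =
  ((≢-sym u≢a ∷ a≢rs) ∷ u≢rs ∷ un) , (∈ᵤ-flip ua ∷ spokes-swap rs es)

swapPages : ∀ {P u a x y rs} → Pages P u a (x ∷ y ∷ rs) → Pages P u a (y ∷ x ∷ rs)
swapPages (((u≢a ∷ u≢x ∷ u≢y ∷ us) ∷ (a≢x ∷ a≢y ∷ as) ∷ (x≢y ∷ xs) ∷ ys ∷ un) , (ua ∷ ux ∷ ax ∷ uy ∷ ay ∷ es)) =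
  ((u≢a ∷ u≢y ∷ u≢x ∷ us) ∷ (a≢y ∷ a≢x ∷ as) ∷ (≢-sym x≢y ∷ ys) ∷ xs ∷ un) , (ua ∷ uy ∷ ay ∷ ux ∷ ax ∷ es)

dropPage : ∀ {P u a x rs} → Pages P u a (x ∷ rs) → Pages P u a rs
dropPage (((u≢a ∷ _ ∷ us) ∷ (_ ∷ as) ∷ _ ∷ un) , (ua ∷ _ ∷ _ ∷ es)) = ((u≢a ∷ us) ∷ as ∷ un) , (ua ∷ es)

addPage : ∀ {P u a r rs} → All (r ≢_) (u ∷ a ∷ rs) → P (u , r) → P (a , r) → Pages P u a rs → Pages P u a (r ∷ rs)
addPage (r≢u ∷ r≢a ∷ r≢rs) ur ar (((u≢a ∷ us) ∷ as ∷ un) , (ua ∷ es)) =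
  ((u≢a ∷ ≢-sym r≢u ∷ us) ∷ (≢-sym r≢a ∷ as) ∷ r≢rs ∷ un) , (ua ∷ ur ∷ ar ∷ es)

-- Vertices outside a book, and pendant edges.

Off : ℕ → Edge → Set
Off d (x , y) = d ≢ x × d ≢ y

off-spokes : ∀ {d u a} rs → All (d ≢_) (u ∷ a ∷ rs) → All (Off d) (spokes u a rs)
off-spokes [] _ = []
off-spokes (_ ∷ rs) (d≢u ∷ d≢a ∷ d≢r ∷ d≢rs) = (d≢u , d≢r) ∷ (d≢a , d≢r) ∷ off-spokes rs (d≢u ∷ d≢a ∷ d≢rs)

off-bookEdges : ∀ {d u a} rs → All (d ≢_) (u ∷ a ∷ rs) → All (Off d) (bookEdges u a rs)
off-bookEdges rs (d≢u ∷ d≢a ∷ d≢rs) = (d≢u , d≢a) ∷ off-spokes rs (d≢u ∷ d≢a ∷ d≢rs)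

Pages-map-off : ∀ {P Q : Edge → Set} {d u a rs} → All (d ≢_) (u ∷ a ∷ rs) →
  (∀ {e} → Off d e → P e → Q e) → Pages P u a rs → Pages Q u a rs
Pages-map-off {rs = rs} d≢ f (un , es) = un , All.map (λ (o , p) → f o p) (All.zip (off-bookEdges rs d≢ , es))

off⇒¬Same : ∀ {d x e} → Off d e → ¬ Same (x , d) e
off⇒¬Same (_ , d≢) (inj₁ (_ , d≡)) = d≢ d≡
off⇒¬Same (d≢ , _) (inj₂ (_ , d≡)) = d≢ d≡

off-∷ : ∀ {d x e r S} → Off d e → Same (x , d) r → e ∈ᵤ r ∷ S → e ∈ᵤ S
off-∷ o s (here t) = contradiction (Same-trans s (Same-sym t)) (off⇒¬Same o)
off-∷ o s (there p) = p

Untouched : ℕ → List Edge → Set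
Untouched d S = ∀ {x} → (x , d) ∉ᵤ S

-- The second clause keeps the first one true after a forced reply `a d`: a diamond based at `a x`
-- together with `a d` would leave only `x d` to claim.
Safe : List Edge → ℕ → List Edge → Set
Safe S₁ a S₂ = (∀ {r} → r ∉ᵤ S₁ → Bookless (r ∷ S₂)) × (∀ {x p q} → ¬ Diamond S₂ a x p q)

module _ {a d r S} (s : Same (a , d) r) (a≢d : a ≢ d) (untouched : Untouched d S) where

  private
    neighbour : ∀ {x} → (x , d) ∈ᵤ r ∷ S → x ≡ a
    neighbour (here t) = Same-pivot t s
    neighbour (there p) = contradiction p untouched

  -- Every vertex of the diamond other than `a` has a neighbour other than `a`, whereas `d` is
  -- joined to `a` only. So the diamond misses `d`, and with it the edge `r`.
  pendant-diamond : ∀ {x p q} → Diamond (r ∷ S) a x p q → Diamond S a x p q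
  pendant-diamond D@(((a≢x ∷ a≢p ∷ a≢q ∷ []) ∷ _) , (_ ∷ _ ∷ xp ∷ _ ∷ xq ∷ [])) = Pages-map-off
    (≢-sym a≢d ∷ (λ { refl → a≢p (sym (neighbour (∈ᵤ-flip xp))) }) ∷
     (λ { refl → a≢x (sym (neighbour xp)) }) ∷ (λ { refl → a≢x (sym (neighbour xq)) }) ∷ [])
    (λ o → off-∷ o s) D

  module _ {r′} (noDiamond : ∀ {x p q} → ¬ Diamond S a x p q) (bookless : Bookless (r′ ∷ S)) where

    private
      S′ : List Edge
      S′ = r′ ∷ r ∷ S

      neighbour′ : ∀ {x} → (x , d) ∈ᵤ S′ → Same (x , d) r′ ⊎ x ≡ a
      neighbour′ (here t) = inj₁ t
      neighbour′ (there p) = inj₂ (neighbour p)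

      -- The two edges at the page `d` can only be `r` and `r′`, so one base vertex is `a`. The
      -- other two pages then form a diamond based at `a`, already inside `S`.
      notPage : ∀ {p q y z} → ¬ Book S′ p q d y z
      notPage B@(((p≢q ∷ p≢d ∷ _) ∷ (q≢d ∷ _) ∷ (d≢y ∷ d≢z ∷ []) ∷ _) , (_ ∷ pd ∷ qd ∷ _))
        with neighbour′ pd | neighbour′ qd
      ... | inj₁ t | inj₁ t′ = p≢q (Same-pivot t t′)
      ... | inj₂ p≡a | inj₂ q≡a = p≢q (trans p≡a (sym q≡a))
      ... | inj₁ t | inj₂ refl = noDiamond (swapBase (Pages-map-off
        (≢-sym p≢d ∷ ≢-sym q≢d ∷ d≢y ∷ d≢z ∷ []) (λ o → off-∷ o s ∘ off-∷ o t) (dropPage B)))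
      ... | inj₂ refl | inj₁ t = noDiamond (Pages-map-off
        (≢-sym p≢d ∷ ≢-sym q≢d ∷ d≢y ∷ d≢z ∷ []) (λ o → off-∷ o s ∘ off-∷ o t) (dropPage B))

      -- A base vertex has degree at least 3, but d has degree at most 2.
      notBase : ∀ {q x y z} → ¬ Book S′ d q x y z
      notBase ((_ ∷ (q≢x ∷ q≢y ∷ _) ∷ (x≢y ∷ _) ∷ _) , (dq ∷ dx ∷ _ ∷ dy ∷ _))
        with neighbour′ (∈ᵤ-flip dq) | neighbour′ (∈ᵤ-flip dx) | neighbour′ (∈ᵤ-flip dy)
      ... | inj₁ t | inj₁ t′ | _ = q≢x (Same-pivot t t′)
      ... | inj₁ t | inj₂ _ | inj₁ t′ = q≢y (Same-pivot t t′)
      ... | inj₂ _ | inj₁ t | inj₁ t′ = x≢y (Same-pivot t t′)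
      ... | inj₁ _ | inj₂ e | inj₂ e′ = x≢y (trans e (sym e′))
      ... | inj₂ e | inj₁ _ | inj₂ e′ = q≢y (trans e (sym e′))
      ... | inj₂ e | inj₂ e′ | _ = q≢x (trans e (sym e′))

    -- A book that misses `d` does not use `r` and already lies in `r′ ∷ S`. The five possible
    -- positions of `d` in a book are excluded one by one.
    pendant-bookless : Bookless (r′ ∷ r ∷ S)
    pendant-bookless {u} {b} {x} {y} {z} B with d ≟ u | d ≟ b | d ≟ x | d ≟ y | d ≟ z
    ... | yes refl | _ | _ | _ | _ = notBase B
    ... | no _ | yes refl | _ | _ | _ = notBase (swapBase B)
    ... | no _ | no _ | yes refl | _ | _ = notPage B
    ... | no _ | no _ | no _ | yes refl | _ = notPage (swapPages B)
    ... | no d≢u | no d≢b | no d≢x | no d≢y | no d≢z = bookless (Pages-map-off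
      (d≢u ∷ d≢b ∷ d≢x ∷ d≢y ∷ d≢z ∷ []) skip B)
      where
      skip : ∀ {e} → Off d e → e ∈ᵤ r′ ∷ r ∷ S → e ∈ᵤ r′ ∷ S
      skip o (here t) = here t
      skip o (there p) = there (off-∷ o s p)
    ... | no _ | no _ | no _ | no _ | yes refl = notPage (rotate B)
      where
      rotate : ∀ {P u a x y z} → Pages P u a (x ∷ y ∷ z ∷ []) → Pages P u a (z ∷ x ∷ y ∷ [])
      rotate (((u≢a ∷ u≢x ∷ u≢y ∷ u≢z ∷ []) ∷ (a≢x ∷ a≢y ∷ a≢z ∷ []) ∷ (x≢y ∷ x≢z ∷ []) ∷ (y≢z ∷ []) ∷ [] ∷ []) ,
              (ua ∷ ux ∷ ax ∷ uy ∷ ay ∷ uz ∷ az ∷ [])) =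
        ((u≢a ∷ u≢z ∷ u≢x ∷ u≢y ∷ []) ∷ (a≢z ∷ a≢x ∷ a≢y ∷ []) ∷ (≢-sym x≢z ∷ ≢-sym y≢z ∷ []) ∷ (x≢y ∷ []) ∷ [] ∷ []) ,
        (ua ∷ uz ∷ az ∷ ux ∷ ax ∷ uy ∷ ay ∷ [])

pendant-safe : ∀ {S₁ S₂ S₁′ a d r} → Same (a , d) r → a ≢ d → Untouched d S₂ →
  (∀ {e} → e ∉ᵤ S₁′ → e ∉ᵤ S₁) → Safe S₁ a S₂ → Safe S₁′ a (r ∷ S₂)
pendant-safe s a≢d un S₁⊆S₁′ (bookless , noDiamond) =
  (λ r∉ → pendant-bookless s a≢d un noDiamond (bookless (S₁⊆S₁′ r∉))) ,
  noDiamond ∘ pendant-diamond s a≢d un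

-- Winning positions and forced replies.

Open : List Edge → List Edge → Edge → Set
Open S₁ S₂ e = proj₁ e ≢ proj₂ e × e ∉ᵤ S₁ × e ∉ᵤ S₂

-- The first player, who owns S₁ against S₂, is to move.
data Wins (S₁ S₂ : List Edge) : Set where
  win  : ∀ {u a x y z} e → Open S₁ S₂ e → Book (e ∷ S₁) u a x y z → Bookless S₂ → Wins S₁ S₂
  move : ∀ e → Open S₁ S₂ e → (∀ r → Open (e ∷ S₁) S₂ r → Wins (e ∷ S₁) (r ∷ S₂)) → Wins S₁ S₂

AllReplies : List Edge → List Edge → Set
AllReplies S₁ S₂ = ∀ r → Open S₁ S₂ r → Wins S₁ (r ∷ S₂)

∉ᵤ-∷ : ∀ {e f S} → ¬ Same e f → e ∉ᵤ S → e ∉ᵤ f ∷ S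
∉ᵤ-∷ ≁ ∉ (here s) = ≁ s
∉ᵤ-∷ ≁ ∉ (there p) = ∉ p

-- After a reply elsewhere the first player completes the book with `t`, and `bookless` ensures that
-- this reply has not completed a book for the opponent.
forced : ∀ {S₁ S₂ u a x y z} t → Book (t ∷ S₁) u a x y z → Open S₁ S₂ t →
  (∀ {r} → r ∉ᵤ S₁ → Bookless (r ∷ S₂)) →
  (∀ r → Open S₁ S₂ r → Same t r → Wins S₁ (r ∷ S₂)) → AllReplies S₁ S₂
forced t book (loopless , t∉S₁ , t∉S₂) bookless blocked r o@(_ , r∉S₁ , _) with same? t r
... | yes s = blocked r o s
... | no ≁ = win t (loopless , t∉S₁ , ∉ᵤ-∷ ≁ t∉S₂) book (bookless r∉S₁)

-- Winning from a safe diamond.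

bound : List Edge → ℕ
bound [] = 0
bound ((x , y) ∷ S) = suc (x + y) + bound S

-- `bound` adds up instead of taking a maximum; either way it exceeds every vertex of `S`.
untouched-bound : ∀ {d} S → bound S ≤ d → Untouched d S
untouched-bound ((x , y) ∷ S) b (here (inj₁ (refl , refl))) =
  <-irrefl refl (≤-trans (s≤s (m≤n+m y x)) (≤-trans (m≤m+n _ (bound S)) b))
untouched-bound ((x , y) ∷ S) b (here (inj₂ (refl , refl))) =
  <-irrefl refl (≤-trans (s≤s (m≤m+n x y)) (≤-trans (m≤m+n _ (bound S)) b))
untouched-bound ((x , y) ∷ S) b (there p) = untouched-bound S (≤-trans (m≤n+m (bound S) _) b) p

fresh : ∀ S₁ S₂ → Σ ℕ λ d → Untouched d S₁ × Untouched d S₂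
fresh S₁ S₂ = bound S₁ + bound S₂ ,
  untouched-bound S₁ (m≤m+n (bound S₁) (bound S₂)) , untouched-bound S₂ (m≤n+m (bound S₂) (bound S₁))

untouched-≢ : ∀ {d x y S} → Untouched d S → (x , y) ∈ᵤ S → d ≢ x × d ≢ y
untouched-≢ un p = (λ { refl → un (∈ᵤ-flip p) }) , (λ { refl → un p })

-- A prospective page `d` of the base `u b`, which lacks only the free edge `b d`.
Spoke : List Edge → List Edge → ℕ → ℕ → ℕ → ℕ → Set
Spoke S₁ S₂ u a b d = All (d ≢_) (u ∷ a ∷ b ∷ []) × (u , d) ∈ᵤ S₁ × (b , d) ∉ᵤ S₁ × (b , d) ∉ᵤ S₂

record Fan (S₁ S₂ : List Edge) (u a b c : ℕ) (ds : List ℕ) : Set where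
  field
    diamond  : Diamond S₁ u a b c
    safe     : Safe S₁ a S₂
    distinct : Unique ds
    pendants : All (Spoke S₁ S₂ u a b) ds

-- The threat to complete a book on {u , a} forces the second player to waste the edge {a , d}.
extend : ∀ {S₁ S₂ u a b c ds} → Fan S₁ S₂ u a b c ds →
  (∀ {S₁′ S₂′ d} → Fan S₁′ S₂′ u a b c (d ∷ ds) → Wins S₁′ S₂′) → Wins S₁ S₂
extend {S₁} {S₂} {u} {a} {b} {c} F@record { diamond = ((u≢a ∷ u≢b ∷ _) ∷ (a≢b ∷ _) ∷ _) , (ua ∷ ub ∷ _ ∷ uc ∷ _) }
  continue with fresh S₁ S₂
... | d , un₁ , un₂ = move (u , d) (≢-sym d≢u , un₁ , un₂)
  (forced (a , d) book (≢-sym d≢a , ∉ᵤ-∷ (λ t → u≢a (sym (Same-pivot t Same-refl))) un₁ , un₂)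
    (proj₁ safe ∘ (_∘ there)) blocked)
  where
  open Fan F
  d≢u : d ≢ u
  d≢u = proj₁ (untouched-≢ un₁ ua)
  d≢a : d ≢ a
  d≢a = proj₂ (untouched-≢ un₁ ua)
  d≢b : d ≢ b
  d≢b = proj₂ (untouched-≢ un₁ ub)
  d≢c : d ≢ c
  d≢c = proj₂ (untouched-≢ un₁ uc)
  book : Book ((a , d) ∷ (u , d) ∷ S₁) u a d b c
  book = addPage (d≢u ∷ d≢a ∷ d≢b ∷ d≢c ∷ []) (there (here Same-refl)) (here Same-refl)
    (Pages-map (there ∘ there) diamond)
  apart : ∀ {v x} → v ≢ b → ¬ Same (b , x) (v , d)
  apart v≢b (inj₁ (b≡v , _)) = v≢b (sym b≡v)
  apart _ (inj₂ (b≡d , _)) = d≢b (sym b≡d)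
  blocked : ∀ r → Open ((u , d) ∷ S₁) S₂ r → Same (a , d) r → Wins ((u , d) ∷ S₁) (r ∷ S₂)
  blocked r _ s = continue record
    { diamond = Pages-map there diamond
    ; safe = pendant-safe s (≢-sym d≢a) un₂ (_∘ there) safe
    ; distinct = All.map (λ (_ , ux , _) → proj₂ (untouched-≢ un₁ ux)) pendants ∷ distinct
    ; pendants = ((d≢u ∷ d≢a ∷ d≢b ∷ []) , here Same-refl , ∉ᵤ-∷ (apart u≢b) un₁ , ∉ᵤ-∷ unblocked un₂) ∷
        All.map (λ (x≢ , ux , bx∉S₁ , bx∉S₂) →
          x≢ , there ux , ∉ᵤ-∷ (apart u≢b) bx∉S₁ , ∉ᵤ-∷ unblocked bx∉S₂) pendants
    }
    where
    unblocked : ∀ {x} → ¬ Same (b , x) r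
    unblocked t = apart a≢b (Same-trans t (Same-sym s))

-- The diamond makes `a` a page of the base `u b`. Claiming `b d` adds the page `d`, and then `b e`
-- and `b f` both complete a book, so that one reply cannot stop them.
fan-wins : ∀ {S₁ S₂ u a b c d e f} → Fan S₁ S₂ u a b c (d ∷ e ∷ f ∷ []) → Wins S₁ S₂
fan-wins {S₁} {S₂} {u} {a} {b} {c} {d} {e} {f} record
  { diamond = ((u≢a ∷ u≢b ∷ _) ∷ (a≢b ∷ _) ∷ _) , (ua ∷ ub ∷ ab ∷ _)
  ; safe = bookless , _
  ; distinct = (d≢e ∷ d≢f ∷ []) ∷ (e≢f ∷ []) ∷ _
  ; pendants = ((d≢u ∷ d≢a ∷ d≢b ∷ []) , ud , bd∉S₁ , bd∉S₂) ∷ spoke-e ∷ spoke-f ∷ [] } =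
  move (b , d) (≢-sym d≢b , bd∉S₁ , bd∉S₂)
    (forced (b , e) (book spoke-e d≢e) (open′ spoke-e d≢e) (bookless ∘ (_∘ there)) second)
  where
  open′ : ∀ {x} → Spoke S₁ S₂ u a b x → d ≢ x → Open ((b , d) ∷ S₁) S₂ (b , x)
  open′ ((_ ∷ _ ∷ x≢b ∷ []) , _ , bx∉S₁ , bx∉S₂) d≢x =
    ≢-sym x≢b , ∉ᵤ-∷ (λ t → d≢x (sym (Same-pivot′ t Same-refl))) bx∉S₁ , bx∉S₂
  book : ∀ {x} → Spoke S₁ S₂ u a b x → d ≢ x → Book ((b , x) ∷ (b , d) ∷ S₁) u b x d a
  book ((x≢u ∷ x≢a ∷ x≢b ∷ []) , ux , _) d≢x =
    ((u≢b ∷ ≢-sym x≢u ∷ ≢-sym d≢u ∷ u≢a ∷ []) ∷ (≢-sym x≢b ∷ ≢-sym d≢b ∷ ≢-sym a≢b ∷ []) ∷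
      (≢-sym d≢x ∷ x≢a ∷ []) ∷ (d≢a ∷ []) ∷ [] ∷ []) ,
    (there (there ub) ∷ there (there ux) ∷ here Same-refl ∷ there (there ud) ∷ there (here Same-refl) ∷
      there (there ua) ∷ there (there (∈ᵤ-flip ab)) ∷ [])
  second : ∀ r → Open ((b , d) ∷ S₁) S₂ r → Same (b , e) r → Wins ((b , d) ∷ S₁) (r ∷ S₂)
  second r (_ , r∉ , _) s with open′ spoke-f d≢f
  ... | b≢f , bf∉₁ , bf∉₂ = win (b , f) (b≢f , bf∉₁ , ∉ᵤ-∷ (e≢f ∘ Same-pivot′ s) bf∉₂)
    (book spoke-f d≢f) (bookless (r∉ ∘ there))

safe-diamond-wins : ∀ {S₁ S₂ u a b c} → Diamond S₁ u a b c → Safe S₁ a S₂ → Wins S₁ S₂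
safe-diamond-wins D safe = extend start λ F → extend F λ F → extend F fan-wins
  where
  start = record { diamond = D ; safe = safe ; distinct = [] ; pendants = [] }

-- Diamonds of the second player at the two ends of a base.

ends : Edge → List ℕ
ends (x , y) = x ∷ y ∷ []

off⇒∉ends : ∀ {v e} → Off v e → v ∉ ends e
off⇒∉ends (v≢x , _) (here v≡x) = v≢x v≡x
off⇒∉ends (_ , v≢y) (there (here v≡y)) = v≢y v≡y

Same-ends : ∀ {v e f} → Same e f → v ∈ ends e → v ∈ ends f
Same-ends (inj₁ (refl , refl)) v∈ = v∈
Same-ends (inj₂ (refl , refl)) (here v≡) = there (here v≡)
Same-ends (inj₂ (refl , refl)) (there (here v≡)) = here v≡

module _ {P : Edge → Set} (P? : Decidable P) where

  ∈ᵤ-filter⁺ : (∀ {e f} → Same e f → P e → P f) → ∀ {e} S → P e → e ∈ᵤ S → e ∈ᵤ filter P? S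
  ∈ᵤ-filter⁺ resp (f ∷ S) pe e∈ with P? f | e∈
  ... | yes _ | here s = here s
  ... | yes _ | there e∈S = there (∈ᵤ-filter⁺ resp S pe e∈S)
  ... | no ¬pf | here s = contradiction (resp s pe) ¬pf
  ... | no _ | there e∈S = ∈ᵤ-filter⁺ resp S pe e∈S

  length-filter-¬ : ∀ S → length (filter P? S) + length (filter (¬? ∘ P?) S) ≡ length S
  length-filter-¬ [] = refl
  length-filter-¬ (f ∷ S) with P? f
  ... | yes _ = cong suc (length-filter-¬ S)
  ... | no _ = trans (+-suc _ _) (cong suc (length-filter-¬ S))

-- A diamond based at a has three edges at a, and one based at u has five edges missing a.
one-side-diamond-free : ∀ {S u a} → length S ≤ 6 → u ≢ a → (u , a) ∉ᵤ S →
  (∀ {x p q} → ¬ Diamond S a x p q) ⊎ (∀ {x p q} → ¬ Diamond S u x p q)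
one-side-diamond-free {S} {u} {a} S≤6 u≢a ua∉S with length (filter (λ e → a ∈? ends e) S) ≤? 2
... | yes few = inj₁ λ (un , es) → <-irrefl refl (≤-trans (distinctEdges⇒length≤ (star un) (inStar es)) few)
  where
  at-a : ∀ {x} → (a , x) ∈ᵤ S → (a , x) ∈ᵤ filter (λ e → a ∈? ends e) S
  at-a = ∈ᵤ-filter⁺ (λ e → a ∈? ends e) Same-ends S (here refl)
  inStar : ∀ {x p q} → All (_∈ᵤ S) (bookEdges a x (p ∷ q ∷ [])) →
    All (_∈ᵤ filter (λ e → a ∈? ends e) S) ((a , x) ∷ (a , p) ∷ (a , q) ∷ [])
  inStar (ax ∷ ap ∷ _ ∷ aq ∷ _ ∷ []) = at-a ax ∷ at-a ap ∷ at-a aq ∷ []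
  star : ∀ {x p q} → Unique (a ∷ x ∷ p ∷ q ∷ []) → Distinct ((a , x) ∷ (a , p) ∷ (a , q) ∷ [])
  star ((_ ∷ a≢p ∷ a≢q ∷ []) ∷ (x≢p ∷ x≢q ∷ []) ∷ (p≢q ∷ []) ∷ _) =
    ([ x≢p ∘ proj₂ , a≢p ∘ proj₁ ]′ ∷ [ x≢q ∘ proj₂ , a≢q ∘ proj₁ ]′ ∷ []) ∷
    ([ p≢q ∘ proj₂ , a≢q ∘ proj₁ ]′ ∷ []) ∷ [] ∷ []
... | no many = inj₂ λ D@(un , es) → <-irrefl refl (≤-trans
  (s≤s (subst (8 ≤_) (length-filter-¬ (λ e → a ∈? ends e) S)
    (+-mono-≤ (≰⇒> many) (distinctEdges⇒length≤ (bookEdges-distinct _ un) (missing D))))) (≤-trans (s≤s S≤6) (n≤1+n 7)))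
  where
  missing : ∀ {x p q} → Diamond S u x p q →
    All (_∈ᵤ filter (λ e → ¬? (a ∈? ends e)) S) (bookEdges u x (p ∷ q ∷ []))
  missing (_ , es@(ux ∷ up ∷ _ ∷ uq ∷ _ ∷ [])) = All.map
    (λ (o , e∈) → ∈ᵤ-filter⁺ (λ e → ¬? (a ∈? ends e)) (λ s → _∘ Same-ends (Same-sym s)) S (off⇒∉ends o) e∈)
    (All.zip (off-bookEdges _ (≢-sym u≢a ∷ ≢a ux ∷ ≢a up ∷ ≢a uq ∷ []) , es))
    where
    ≢a : ∀ {v} → (u , v) ∈ᵤ S → a ≢ v
    ≢a uv refl = ua∉S uv

-- How far the second player is from a book.

Disjoint : List Edge → List Edge → Set
Disjoint S₁ S₂ = ∀ {e} → e ∈ᵤ S₁ → e ∉ᵤ S₂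

disjoint-claim : ∀ {S₁ S₂ e} → Disjoint S₁ S₂ → e ∉ᵤ S₂ → Disjoint (e ∷ S₁) S₂
disjoint-claim disjoint e∉S₂ (here s) q = e∉S₂ (∈ᵤ-resp s q)
disjoint-claim disjoint e∉S₂ (there p) q = disjoint p q

disjoint-reply : ∀ {S₁ S₂ r} → Disjoint S₁ S₂ → r ∉ᵤ S₁ → Disjoint S₁ (r ∷ S₂)
disjoint-reply disjoint r∉S₁ p (here s) = r∉S₁ (∈ᵤ-resp s p)
disjoint-reply disjoint r∉S₁ p (there q) = disjoint p q

-- Here `k` counts the replies that the second player can still make without owning a book. When `k`
-- has dropped to 1, `size` leaves him at most six edges, as `one-side-diamond-free` requires.
record Slack (k : ℕ) (S₁ S₂ : List Edge) : Set where
  field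
    disjoint : Disjoint S₁ S₂
    size     : k + length S₂ ≤ 7
    far      : ∀ R → length R ≤ k → All (_∉ᵤ S₁) R → Bookless (R ++ S₂)

slack-reply : ∀ {k S₁ S₂ r} → Slack (suc k) S₁ S₂ → r ∉ᵤ S₁ → Slack k S₁ (r ∷ S₂)
slack-reply {k} {S₁} {S₂} {r} sl r∉ = record
  { disjoint = disjoint-reply disjoint r∉
  ; size = subst (_≤ 7) (sym (+-suc k (length S₂))) size
  ; far = λ R R≤k R∉ B → far (r ∷ R) (s≤s R≤k) (r∉ ∷ R∉) (Pages-map (Any-resp-↭ (shift r R S₂)) B)
  }
  where open Slack sl

slack-play : ∀ {k S₁ S₂ e} → Slack k S₁ S₂ → e ∉ᵤ S₂ → Slack k (e ∷ S₁) S₂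
slack-play sl e∉ = record
  { disjoint = disjoint-claim disjoint e∉
  ; size = size
  ; far = λ R R≤k R∉ → far R R≤k (All.map (_∘ there) R∉)
  }
  where open Slack sl

slack-resp : ∀ {k S₁ S t r} → Same t r → Slack k S₁ (t ∷ S) → Slack k S₁ (r ∷ S)
slack-resp {S = S} {t} {r} s sl = record
  { disjoint = λ p q → disjoint p (convert q)
  ; size = size
  ; far = λ R R≤k R∉ B → far R R≤k R∉ (Pages-map
    (Any-resp-↭ (↭-sym (shift t R S)) ∘ convert ∘ Any-resp-↭ (shift r R S)) B)
  }
  where
  open Slack sl
  convert : ∀ {e S} → e ∈ᵤ r ∷ S → e ∈ᵤ t ∷ S
  convert (here s′) = here (Same-trans s′ (Same-sym s))
  convert (there p) = there p

few-edges-bookless : ∀ {S} → length S ≤ 6 → Bookless S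
few-edges-bookless S≤6 (un , es) =
  <-irrefl refl (≤-trans (distinctEdges⇒length≤ (bookEdges-distinct _ un) es) S≤6)

-- From triangles, kites and diamonds to a win.

-- The second player lacks diamonds at one end of the base; that end is made to receive his forced
-- replies, after `swapBase` if it is `u`. The slack of one gives the first clause of `Safe`.
diamond-wins : ∀ {S₁ S₂ u a b c} → Slack 1 S₁ S₂ → Diamond S₁ u a b c → Wins S₁ S₂
diamond-wins {S₁} {S₂} {u} {a} sl D@(((u≢a ∷ _) ∷ _) , (ua ∷ _))
  with one-side-diamond-free {S₂} {u} {a} (s≤s⁻¹ (Slack.size sl)) u≢a (Slack.disjoint sl ua)
... | inj₁ free = safe-diamond-wins D ((λ r∉ → Slack.far sl _ ≤-refl (r∉ ∷ [])) , free)
... | inj₂ free = safe-diamond-wins (swapBase D) ((λ r∉ → Slack.far sl _ ≤-refl (r∉ ∷ [])) , free)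

diamond-closes : ∀ {S₁ S₂ u a b c} → Slack 2 S₁ S₂ → Diamond S₁ u a b c → AllReplies S₁ S₂
diamond-closes sl D r (_ , r∉ , _) = diamond-wins (slack-reply sl r∉) D

-- As `u x` is already owned, the diamond threatens `a x` at once. The reply is thus known in
-- advance, and slack is asked only of the position that contains it, a weaker demand than
-- `Slack 2 S₁ S₂`.
threat-closes : ∀ {S₁ S₂ u a b c x} → Slack 1 S₁ ((a , x) ∷ S₂) → Diamond S₁ u a b c →
  All (x ≢_) (u ∷ a ∷ b ∷ c ∷ []) → (u , x) ∈ᵤ S₁ → Open S₁ S₂ (a , x) → AllReplies S₁ S₂
threat-closes sl D x≢ ux o = forced _
  (addPage x≢ (there ux) (here Same-refl) (Pages-map there D)) o
  -- With the reply counted, `size` leaves at most six edges, one too few for a book.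
  (λ _ → few-edges-bookless (s≤s⁻¹ (Slack.size sl)))
  (λ r _ s → diamond-wins (slack-resp s sl) D)

-- Both `p d` and `q d` turn the triangle into a diamond, with base `s p` or `s q`, and one reply
-- cannot take both.
kite-closes : ∀ {S₁ S₂ s p q d} → Slack 3 S₁ S₂ → Pages (_∈ᵤ S₁) s p (q ∷ []) →
  d ≢ s → (s , d) ∈ᵤ S₁ → Open S₁ S₂ (p , d) → Open S₁ S₂ (q , d) → AllReplies S₁ S₂
kite-closes {S₁} {S₂} {s} {p} {q} {d} sl T@((_ ∷ (p≢q ∷ []) ∷ _) , _) d≢s sd
  (p≢d , pd∉S₁ , pd∉S₂) (q≢d , qd∉S₁ , qd∉S₂) r (_ , r∉ , _) with same? (p , d) r
... | yes pd~r = move (q , d) (q≢d , qd∉S₁ , qd∉) (diamond-closes (slack-play (slack-reply sl r∉) qd∉)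
    (addPage (d≢s ∷ ≢-sym q≢d ∷ ≢-sym p≢d ∷ []) (there sd) (here Same-refl) (Pages-map there (turn T))))
  where
  qd∉ : (q , d) ∉ᵤ r ∷ S₂
  qd∉ = ∉ᵤ-∷ (p≢q ∘ Same-pivot pd~r) qd∉S₂
  turn : Pages (_∈ᵤ S₁) s p (q ∷ []) → Pages (_∈ᵤ S₁) s q (p ∷ [])
  turn (((s≢p ∷ s≢q ∷ []) ∷ (p≢q ∷ []) ∷ [] ∷ []) , (sp ∷ sq ∷ pq ∷ [])) =
    ((s≢q ∷ s≢p ∷ []) ∷ (≢-sym p≢q ∷ []) ∷ [] ∷ []) , (sq ∷ sp ∷ ∈ᵤ-flip pq ∷ [])
... | no pd≁r = move (p , d) (p≢d , pd∉S₁ , pd∉) (diamond-closes (slack-play (slack-reply sl r∉) pd∉)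
    (addPage (d≢s ∷ ≢-sym p≢d ∷ ≢-sym q≢d ∷ []) (there sd) (here Same-refl) (Pages-map there T)))
  where
  pd∉ : (p , d) ∉ᵤ r ∷ S₂
  pd∉ = ∉ᵤ-∷ pd≁r pd∉S₂

-- A fresh pendant edge at `s` gives a kite. Of the slack of four, one unit each goes to the replies
-- to the triangle, the kite and the diamond; the last is left for `diamond-wins`.
triangle-closes : ∀ {S₁ S₂ s p q} → Slack 4 S₁ S₂ → Pages (_∈ᵤ S₁) s p (q ∷ []) → AllReplies S₁ S₂
triangle-closes {S₁} {S₂} {s} {p} {q} sl T@(((s≢p ∷ s≢q ∷ []) ∷ _) , (sp ∷ sq ∷ _)) r (_ , r∉ , _)
  with fresh S₁ (r ∷ S₂)
... | d , un₁ , un₂ = move (s , d) (≢-sym d≢s , un₁ , un₂)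
  (kite-closes (slack-play (slack-reply sl r∉) un₂) (Pages-map there T) d≢s (here Same-refl)
    (open′ s≢p sp) (open′ s≢q sq))
  where
  d≢s : d ≢ s
  d≢s = proj₁ (untouched-≢ un₁ sp)
  open′ : ∀ {x} → s ≢ x → (s , x) ∈ᵤ S₁ → Open ((s , d) ∷ S₁) (r ∷ S₂) (x , d)
  open′ s≢x sx = ≢-sym (proj₂ (untouched-≢ un₁ sx)) ,
    ∉ᵤ-∷ (λ t → s≢x (sym (Same-pivot t Same-refl))) un₁ , un₂

-- A decidable test that edges do not fit into one book.

vertices : List Edge → List ℕ
vertices S = deduplicate _≟_ (concatMap ends S)

∈-vertices⁺ : ∀ {v e S} → v ∈ ends e → e ∈ᵤ S → v ∈ vertices S
∈-vertices⁺ {S = S} v∈e e∈S = ∈-deduplicate⁺ _≟_ (∈-concatMap⁺ ends (Any.map (λ s → Same-ends s v∈e) e∈S))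

∈-vertices⁻ : ∀ {v} S → v ∈ vertices S → ∃ λ e → e ∈ S × v ∈ ends e
∈-vertices⁻ S v∈ = find (∈-concatMap⁻ ends (∈-deduplicate⁻ _≟_ (concatMap ends S) v∈))

-- Obstacles to `p q` being the base of a book that contains `B` and avoids `A`: a loop; a base edge
-- in `A`; an edge of `B` that misses the base; or a vertex of `B` that would have to be a page
-- although one of its two edges is in `A`.
Refuted : List Edge → List Edge → ℕ → ℕ → Set
Refuted A B p q = p ≡ q ⊎ (p , q) ∈ᵤ A ⊎ Any (λ e → p ∉ ends e × q ∉ ends e) B ⊎
  Any (λ v → v ≢ p × v ≢ q × ((p , v) ∈ᵤ A ⊎ (q , v) ∈ᵤ A)) (vertices B)

refuted? : ∀ A B p q → Dec (Refuted A B p q)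
refuted? A B p q = p ≟ q ⊎-dec (p , q) ∈ᵤ? A ⊎-dec
  any? (λ e → ¬? (p ∈? ends e) ×-dec ¬? (q ∈? ends e)) B ⊎-dec
  any? (λ v → ¬? (v ≟ p) ×-dec ¬? (v ≟ q) ×-dec ((p , v) ∈ᵤ? A ⊎-dec (q , v) ∈ᵤ? A)) (vertices B)

refuted-sym : ∀ {A B p q} → Refuted A B p q → Refuted A B q p
refuted-sym (inj₁ p≡q) = inj₁ (sym p≡q)
refuted-sym (inj₂ (inj₁ pq)) = inj₂ (inj₁ (∈ᵤ-flip pq))
refuted-sym (inj₂ (inj₂ (inj₁ miss))) = inj₂ (inj₂ (inj₁ (Any.map swap miss)))
refuted-sym (inj₂ (inj₂ (inj₂ page))) =
  inj₂ (inj₂ (inj₂ (Any.map (λ (≢p , ≢q , pv) → ≢q , ≢p , [ inj₂ , inj₁ ]′ pv) page)))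

-- If all edges of e ∷ B lie in one book, then one base vertex p is an end of e, and the other base vertex is
-- an end of any edge that misses p.
Scattered : List Edge → List Edge → Set
Scattered A [] = ⊥
Scattered A (e ∷ B) = 6 ≤ length (vertices (e ∷ B)) ⊎
  All (λ p → Any (λ f → p ∉ ends f × All (Refuted A (e ∷ B) p) (ends f)) B) (ends e)

scattered? : ∀ A B → Dec (Scattered A B)
scattered? A [] = no λ ()
scattered? A (e ∷ B) = 6 ≤? length (vertices (e ∷ B)) ⊎-dec
  all? (λ p → any? (λ f → ¬? (p ∈? ends f) ×-dec all? (refuted? A (e ∷ B) p) (ends f)) B) (ends e)

bookEdge-ends : ∀ {v e u a} rs → e ∈ᵤ bookEdges u a rs → v ∈ ends e → v ∈ u ∷ a ∷ rs
bookEdge-ends {v} rs (here s) v∈e with Same-ends s v∈e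
... | here v≡u = here v≡u
... | there (here v≡a) = there (here v≡a)
bookEdge-ends {v} {e} {u} {a} rs (there e∈) v∈e = go rs e∈
  where
  extra : ∀ {r rs} → v ∈ u ∷ a ∷ rs → v ∈ u ∷ a ∷ r ∷ rs
  extra (here v≡u) = here v≡u
  extra (there (here v≡a)) = there (here v≡a)
  extra (there (there v∈rs)) = there (there (there v∈rs))
  go : ∀ rs → e ∈ᵤ spokes u a rs → v ∈ u ∷ a ∷ rs
  go (r ∷ rs) (here s) with Same-ends s v∈e
  ... | here v≡u = here v≡u
  ... | there (here v≡r) = there (there (here v≡r))
  go (r ∷ rs) (there (here s)) with Same-ends s v∈e
  ... | here v≡a = there (here v≡a)
  ... | there (here v≡r) = there (there (here v≡r))
  go (r ∷ rs) (there (there e∈)) = extra (go rs e∈)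

bookEdge-base : ∀ {e u a} rs → e ∈ᵤ bookEdges u a rs → u ∈ ends e ⊎ a ∈ ends e
bookEdge-base rs (here s) = inj₁ (Same-ends (Same-sym s) (here refl))
bookEdge-base (r ∷ rs) (there (here s)) = inj₁ (Same-ends (Same-sym s) (here refl))
bookEdge-base (r ∷ rs) (there (there (here s))) = inj₂ (Same-ends (Same-sym s) (here refl))
bookEdge-base (r ∷ rs) (there (there (there e∈))) with rs
... | r′ ∷ rs′ = bookEdge-base (r′ ∷ rs′) (there e∈)

page-spokes : ∀ {P : Edge → Set} {u a v} rs → v ∈ rs → All P (spokes u a rs) → P (u , v) × P (a , v)
page-spokes (_ ∷ rs) (here refl) (uv ∷ av ∷ _) = uv , av
page-spokes (_ ∷ rs) (there v∈) (_ ∷ _ ∷ es) = page-spokes rs v∈ es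

module _ {A B u a rs} (pages : Pages (_∉ᵤ A) u a rs) (covered : All (_∈ᵤ bookEdges u a rs) B) where

  ¬refuted : ¬ Refuted A B u a
  ¬refuted (inj₁ refl) = All.lookup (AllPairs.head (proj₁ pages)) (here refl) refl
  ¬refuted (inj₂ (inj₁ ua)) = All.head (proj₂ pages) ua
  ¬refuted (inj₂ (inj₂ (inj₁ miss))) with find miss
  ... | e , e∈B , u∉e , a∉e = [ u∉e , a∉e ]′ (bookEdge-base rs (All.lookup covered e∈B))
  ¬refuted (inj₂ (inj₂ (inj₂ page))) with find page
  ... | v , v∈B , v≢u , v≢a , taken with ∈-vertices⁻ B v∈B
  ... | e , e∈B , v∈e with bookEdge-ends rs (All.lookup covered e∈B) v∈e
  ... | here v≡u = v≢u v≡u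
  ... | there (here v≡a) = v≢a v≡a
  ... | there (there v∈rs) with page-spokes rs v∈rs (All.tail (proj₂ pages))
  ... | uv∉A , av∉A = [ uv∉A , av∉A ]′ taken

  bounded-vertices : length (vertices B) ≤ length (u ∷ a ∷ rs)
  bounded-vertices = distinct⇒length≤ _≡_ (λ x≡z y≡z → trans x≡z (sym y≡z)) (deduplicate-! _≟_ (concatMap ends B))
    (All.tabulate λ v∈ → let (e , e∈B , v∈e) = ∈-vertices⁻ B v∈ in bookEdge-ends rs (All.lookup covered e∈B) v∈e)

scattered-sound : ∀ {A B u a x y z} → Pages (_∉ᵤ A) u a (x ∷ y ∷ z ∷ []) → Scattered A B →
  ¬ All (_∈ᵤ bookEdges u a (x ∷ y ∷ z ∷ [])) B
scattered-sound {B = e ∷ B} pages (inj₁ many) covered =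
  <-irrefl refl (≤-trans many (bounded-vertices pages covered))
scattered-sound {B = e ∷ B} pages (inj₂ refuted) covered@(e∈ ∷ B∈) with bookEdge-base _ e∈
... | inj₁ u∈e with find (All.lookup refuted u∈e)
... | f , f∈B , u∉f , refutedf with bookEdge-base _ (All.lookup B∈ f∈B)
... | inj₁ u∈f = u∉f u∈f
... | inj₂ a∈f = ¬refuted pages covered (All.lookup refutedf a∈f)
scattered-sound {A} {e ∷ B} pages (inj₂ refuted) covered@(e∈ ∷ B∈) | inj₂ a∈e with find (All.lookup refuted a∈e)
... | f , f∈B , a∉f , refutedf with bookEdge-base _ (All.lookup B∈ f∈B)
... | inj₁ u∈f = ¬refuted pages covered (refuted-sym {A} {e ∷ B} (All.lookup refutedf u∈f))
... | inj₂ a∈f = a∉f a∈f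

SlackCheck : ℕ → List Edge → List Edge → Set
SlackCheck k A B = k + length B ≤ 6 ⊎ (k + length B ≤ 7 × Scattered A B)

slackCheck? : ∀ k A B → Dec (SlackCheck k A B)
slackCheck? k A B = k + length B ≤? 6 ⊎-dec (k + length B ≤? 7 ×-dec scattered? A B)

length-++-≤ : ∀ {k m} (R S : List Edge) → length R ≤ k → k + length S ≤ m → length (R ++ S) ≤ m
length-++-≤ R S R≤k kS≤m = subst (_≤ _) (sym (length-++ R)) (≤-trans (+-monoˡ-≤ (length S) R≤k) kS≤m)

-- A book inside a list of at most seven edges uses each of them.
slack-sound : ∀ {k A B} → Disjoint A B → SlackCheck k A B → Slack k A B
slack-sound {B = B} dis (inj₁ small) = record
  { disjoint = dis
  ; size = ≤-trans small (n≤1+n 6)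
  ; far = λ R R≤k _ → few-edges-bookless (length-++-≤ R B R≤k small)
  }
slack-sound {k} {A} {B} dis (inj₂ (size , scattered)) = record
  { disjoint = dis ; size = size ; far = far }
  where
  far : ∀ R → length R ≤ k → All (_∉ᵤ A) R → Bookless (R ++ B)
  far R R≤k R∉A (un , es) = scattered-sound (un , All.map avoid es) scattered
    (++⁻ʳ R (distinctEdges-cover (bookEdges-distinct _ un) es (length-++-≤ R B R≤k size)))
    where
    avoid : ∀ {e} → e ∈ᵤ R ++ B → e ∉ᵤ A
    avoid e∈ e∈A with ++⁻ R e∈
    ... | inj₂ e∈B = dis e∈A e∈B
    ... | inj₁ e∈R with find e∈R
    ... | r , r∈R , s = All.lookup R∉A r∈R (∈ᵤ-resp s e∈A)

-- Renaming vertices in a winning position.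

module Relabel (φ : ℕ → ℕ) (involutive : ∀ v → φ (φ v) ≡ v) where

  φₑ : Edge → Edge
  φₑ = ×-map φ φ

  φₑ-involutive : ∀ e → φₑ (φₑ e) ≡ e
  φₑ-involutive (x , y) = cong₂ _,_ (involutive x) (involutive y)

  φ-injective : ∀ {x y} → φ x ≡ φ y → x ≡ y
  φ-injective eq = trans (sym (involutive _)) (trans (cong φ eq) (involutive _))

  Same-φ : ∀ {e f} → Same e f → Same (φₑ e) (φₑ f)
  Same-φ (inj₁ (refl , refl)) = inj₁ (refl , refl)
  Same-φ (inj₂ (refl , refl)) = inj₂ (refl , refl)

  infix 4 _↝_
  _↝_ : List Edge → List Edge → Set
  S ↝ T = ∀ {e} → e ∈ᵤ S → φₑ e ∈ᵤ T

  ↝-∷ : ∀ {S T e} → S ↝ T → e ∷ S ↝ φₑ e ∷ T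
  ↝-∷ f (here s) = here (Same-φ s)
  ↝-∷ f (there p) = there (f p)

  ↝-∷˘ : ∀ {S T e} → S ↝ T → φₑ e ∷ S ↝ e ∷ T
  ↝-∷˘ {e = e} f (here s) = here (subst (Same _) (φₑ-involutive e) (Same-φ s))
  ↝-∷˘ f (there p) = there (f p)

  ∉-φ : ∀ {S T e} → T ↝ S → e ∉ᵤ S → φₑ e ∉ᵤ T
  ∉-φ {S} {e = e} f e∉ p = e∉ (subst (_∈ᵤ S) (φₑ-involutive e) (f p))

  open-φ : ∀ {S₁ S₂ T₁ T₂ e} → T₁ ↝ S₁ → T₂ ↝ S₂ → Open S₁ S₂ e → Open T₁ T₂ (φₑ e)
  open-φ f₁ f₂ (e≢ , ∉₁ , ∉₂) = e≢ ∘ φ-injective , ∉-φ f₁ ∉₁ , ∉-φ f₂ ∉₂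

  spokes-φ : ∀ {S T u a} rs → S ↝ T → All (_∈ᵤ S) (spokes u a rs) →
    All (_∈ᵤ T) (spokes (φ u) (φ a) (map φ rs))
  spokes-φ [] f [] = []
  spokes-φ (r ∷ rs) f (ur ∷ ar ∷ es) = f ur ∷ f ar ∷ spokes-φ rs f es

  pages-φ : ∀ {S T u a rs} → S ↝ T → Pages (_∈ᵤ S) u a rs → Pages (_∈ᵤ T) (φ u) (φ a) (map φ rs)
  pages-φ {rs = rs} f (un , (ua ∷ es)) = Unique-map⁺ φ-injective un , (f ua ∷ spokes-φ rs f es)

  -- Moves are carried over by `φ`. A reply is carried back to select the continuation, again by
  -- `φ`, which is its own inverse.
  wins-φ : ∀ {S₁ S₂ T₁ T₂} → S₁ ↝ T₁ → T₁ ↝ S₁ → S₂ ↝ T₂ → T₂ ↝ S₂ → Wins S₁ S₂ → Wins T₁ T₂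
  wins-φ f₁ g₁ f₂ g₂ (win e o book bookless) =
    win (φₑ e) (open-φ g₁ g₂ o) (pages-φ (↝-∷ f₁) book) (bookless ∘ pages-φ g₂)
  wins-φ f₁ g₁ f₂ g₂ (move e o next) = move (φₑ e) (open-φ g₁ g₂ o) λ r o′ →
    wins-φ (↝-∷ f₁) (↝-∷˘ g₁) (↝-∷˘ f₂) (↝-∷ g₂) (next (φₑ r) (open-φ (↝-∷ f₁) f₂ o′))

-- Relabelling by the identity suffices, because `_↝_` compares edges up to orientation.
wins-resp : ∀ {A B r r′} → Same r r′ → Wins A (r ∷ B) → Wins A (r′ ∷ B)
wins-resp s = wins-φ id id
  (λ { (here t) → here (Same-trans t s) ; (there p) → there p })
  (λ { (here t) → here (Same-trans t (Same-sym s)) ; (there p) → there p })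
  where open Relabel id (λ _ → refl)

transpose : ℕ → ℕ → ℕ → ℕ
transpose i j v with v ≟ i | v ≟ j
... | yes _ | _ = j
... | no _ | yes _ = i
... | no _ | no _ = v

transpose-first : ∀ i j → transpose i j i ≡ j
transpose-first i j with i ≟ i
... | yes _ = refl
... | no i≢i = contradiction refl i≢i

transpose-second : ∀ i j → transpose i j j ≡ i
transpose-second i j with j ≟ i | j ≟ j
... | yes j≡i | _ = j≡i
... | no _ | yes _ = refl
... | no _ | no j≢j = contradiction refl j≢j

transpose-other : ∀ {i j v} → v ≢ i → v ≢ j → transpose i j v ≡ v
transpose-other {i} {j} {v} v≢i v≢j with v ≟ i | v ≟ j
... | yes v≡i | _ = contradiction v≡i v≢i
... | no _ | yes v≡j = contradiction v≡j v≢j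
... | no _ | no _ = refl

transpose-involutive : ∀ i j v → transpose i j (transpose i j v) ≡ v
transpose-involutive i j v with v ≟ i | v ≟ j
... | yes refl | _ = transpose-second v j
... | no _ | yes refl = transpose-first i v
... | no v≢i | no v≢j = transpose-other v≢i v≢j

Untouched₂ : ℕ → List Edge → List Edge → Set
Untouched₂ d A B = Untouched d A × Untouched d B

-- As `x` and `y` are untouched, the transposition fixes all edges of `A` and `B` and affects only
-- `r`.
rename : ∀ {A B} x y {r} → Untouched₂ x A B → Untouched₂ y A B →
  Wins A (r ∷ B) → Wins A (×-map (transpose x y) (transpose x y) r ∷ B)
rename x y (xA , xB) (yA , yB) = wins-φ (fixed xA yA) (fixed xA yA) (↝-∷ (fixed xB yB)) (↝-∷˘ (fixed xB yB))
  where
  open Relabel (transpose x y) (transpose-involutive x y)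
  fixed : ∀ {S} → Untouched x S → Untouched y S → S ↝ S
  fixed {S} xS yS e∈ = subst (_∈ᵤ S) (sym (cong₂ _,_
    (transpose-other (≢-sym (proj₁ (untouched-≢ xS e∈))) (≢-sym (proj₁ (untouched-≢ yS e∈))))
    (transpose-other (≢-sym (proj₂ (untouched-≢ xS e∈))) (≢-sym (proj₂ (untouched-≢ yS e∈)))))) e∈

-- Finitely many replies up to renaming.

pairs : List ℕ → List Edge
pairs [] = []
pairs (x ∷ xs) = map (x ,_) xs ++ pairs xs

pairs-complete : ∀ {x y} xs → x ∈ xs → y ∈ xs → x ≢ y → (x , y) ∈ᵤ pairs xs
pairs-complete (_ ∷ xs) (here refl) (here refl) x≢y = contradiction refl x≢y
pairs-complete (x ∷ xs) (here refl) (there y∈) _ = ++⁺ˡ (∈⇒∈ᵤ (∈-map⁺ (x ,_) y∈))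
pairs-complete (y ∷ xs) (there x∈) (here refl) _ = ++⁺ˡ (∈ᵤ-flip (∈⇒∈ᵤ (∈-map⁺ (y ,_) x∈)))
pairs-complete (z ∷ xs) (there x∈) (there y∈) x≢y = ++⁺ʳ (map (z ,_) xs) (pairs-complete xs x∈ y∈ x≢y)

-- The vertices 0, …, 4 are reserved for the opening plan of the first player.
newcomer : List Edge → List Edge → ℕ
newcomer A B = 5 + bound (A ++ B)

replies : List Edge → List Edge → List Edge
replies A B = (newcomer A B , suc (newcomer A B)) ∷ pairs (newcomer A B ∷ vertices (A ++ B))

all-replies : ∀ {A B} → All (λ r → Open A B r → Wins A (r ∷ B)) (replies A B) → AllReplies A B
all-replies {A} {B} good (x , y) o@(x≢y , _) = cases (x ∈? V) (y ∈? V)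
  where
  V = vertices (A ++ B)
  v = newcomer A B
  Unt : ℕ → Set
  Unt d = Untouched₂ d A B
  outside : ∀ {d} → d ∉ V → Unt d
  outside d∉ = (λ p → d∉ (∈-vertices⁺ (there (here refl)) (++⁺ˡ p))) ,
               (λ p → d∉ (∈-vertices⁺ (there (here refl)) (++⁺ʳ A p)))
  beyond : ∀ {d} → bound (A ++ B) ≤ d → Unt d
  beyond b = (λ p → untouched-bound (A ++ B) b (++⁺ˡ p)) , (λ p → untouched-bound (A ++ B) b (++⁺ʳ A p))
  v-new : Unt v
  v-new = beyond (m≤n+m _ 5)
  w-new : Unt (suc v)
  w-new = beyond (m≤n+m _ 6)
  open-new : ∀ {d z} → Unt d → z ≢ d → Open A B (z , d)
  open-new (dA , dB) z≢d = z≢d , dA , dB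
  open-resp : ∀ {e f} → Same e f → Open A B e → Open A B f
  open-resp s (e≢ , ∉₁ , ∉₂) = loopless s e≢ , ∉₁ ∘ ∈ᵤ-resp (Same-sym s) , ∉₂ ∘ ∈ᵤ-resp (Same-sym s)
    where
    loopless : ∀ {a b c d} → Same (a , b) (c , d) → a ≢ b → c ≢ d
    loopless (inj₁ (refl , refl)) = id
    loopless (inj₂ (refl , refl)) = ≢-sym
  canonical : ∀ {r} → r ∈ᵤ replies A B → Open A B r → Wins A (r ∷ B)
  canonical r∈ o with find r∈
  ... | r′ , r′∈ , s = wins-resp (Same-sym s) (All.lookup good r′∈ (open-resp s o))
  V≢v : ∀ {z} → z ∈ V → z ≢ v
  V≢v z∈ refl with ∈-vertices⁻ (A ++ B) z∈
  ... | (p , q) , e∈ , v∈ with ++⁻ A (∈⇒∈ᵤ e∈)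
  ... | inj₁ e∈A = off⇒∉ends (untouched-≢ (proj₁ v-new) e∈A) v∈
  ... | inj₂ e∈B = off⇒∉ends (untouched-≢ (proj₂ v-new) e∈B) v∈
  one-new : ∀ {z d} → z ∈ V → d ∉ V → Wins A ((z , d) ∷ B)
  one-new {z} {d} z∈ d∉ = subst (λ e → Wins A (e ∷ B))
    (cong₂ _,_ (transpose-other (V≢v z∈) (λ { refl → d∉ z∈ })) (transpose-first v d))
    (rename v d v-new (outside d∉)
      (canonical (there (pairs-complete _ (there z∈) (here refl) (V≢v z∈))) (open-new v-new (V≢v z∈))))
  cases : Dec (x ∈ V) → Dec (y ∈ V) → Wins A ((x , y) ∷ B)
  cases (yes x∈) (yes y∈) = canonical (there (pairs-complete _ (there x∈) (there y∈) x≢y)) o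
  cases (yes x∈) (no y∉) = one-new x∈ y∉
  cases (no x∉) (yes y∈) = wins-resp Same-flip (one-new y∈ x∉)
  -- Two renamings in turn: `v` becomes `x`, and then `w′`, the image of `suc v` under the first
  -- one, becomes `y`. The second fixes `x`, which differs from both `w′` and `y`.
  cases (no x∉) (no y∉) = subst (λ e → Wins A (e ∷ B))
    (cong₂ _,_ (transpose-other x≢w′ x≢y) (transpose-first w′ y))
    (rename w′ y w′-new (outside y∉)
      (subst (λ z → Wins A ((z , w′) ∷ B)) (transpose-first v x)
        (rename v x v-new (outside x∉) (canonical (here Same-refl) (open-new w-new (<⇒≢ (n<1+n v)))))))
    where
    w′ = transpose v x (suc v)
    w′-new : Unt w′
    w′-new with suc v ≟ v | suc v ≟ x
    ... | yes _ | _ = outside x∉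
    ... | no _ | yes _ = v-new
    ... | no _ | no _ = w-new
    x≢w′ : x ≢ w′
    x≢w′ eq = <⇒≢ (n<1+n v) (Relabel.φ-injective (transpose v x) (transpose-involutive v x)
      (trans (transpose-first v x) eq))

-- Plans for the opening and their verification.

data Closing : Set where
  triangle : (s p q : ℕ) → Closing
  kite     : (s p q d : ℕ) → Closing
  diamond  : (u a b c : ℕ) → Closing
  threat   : (u a b c x : ℕ) → Closing

Closes : Closing → List Edge → List Edge → Set
Closes (triangle s p q) A B = Pages (_∈ᵤ A) s p (q ∷ []) × SlackCheck 4 A B
Closes (kite s p q d) A B = Pages (_∈ᵤ A) s p (q ∷ []) × d ≢ s × (s , d) ∈ᵤ A ×
  Open A B (p , d) × Open A B (q , d) × SlackCheck 3 A B
Closes (diamond u a b c) A B = Diamond A u a b c × SlackCheck 2 A B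
Closes (threat u a b c x) A B = Diamond A u a b c × All (x ≢_) (u ∷ a ∷ b ∷ c ∷ []) ×
  (u , x) ∈ᵤ A × Open A B (a , x) × SlackCheck 1 A ((a , x) ∷ B)

open? : ∀ S₁ S₂ e → Dec (Open S₁ S₂ e)
open? S₁ S₂ e = ¬? (proj₁ e ≟ proj₂ e) ×-dec ¬? (e ∈ᵤ? S₁) ×-dec ¬? (e ∈ᵤ? S₂)

pages? : ∀ S u a rs → Dec (Pages (_∈ᵤ S) u a rs)
pages? S u a rs = unique? _≟_ (u ∷ a ∷ rs) ×-dec all? (_∈ᵤ? S) (bookEdges u a rs)

closes? : ∀ c A B → Dec (Closes c A B)
closes? (triangle s p q) A B = pages? A s p (q ∷ []) ×-dec slackCheck? 4 A B
closes? (kite s p q d) A B = pages? A s p (q ∷ []) ×-dec ¬? (d ≟ s) ×-dec (s , d) ∈ᵤ? A ×-dec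
  open? A B (p , d) ×-dec open? A B (q , d) ×-dec slackCheck? 3 A B
closes? (diamond u a b c) A B = pages? A u a (b ∷ c ∷ []) ×-dec slackCheck? 2 A B
closes? (threat u a b c x) A B = pages? A u a (b ∷ c ∷ []) ×-dec
  all? (λ v → ¬? (x ≟ v)) (u ∷ a ∷ b ∷ c ∷ []) ×-dec (u , x) ∈ᵤ? A ×-dec open? A B (a , x) ×-dec
  slackCheck? 1 A ((a , x) ∷ B)

closes-sound : ∀ c {A B} → Disjoint A B → Closes c A B → AllReplies A B
closes-sound (triangle s p q) dis (T , slack) = triangle-closes (slack-sound dis slack) T
closes-sound (kite s p q d) dis (T , d≢s , sd , pd , qd , slack) = kite-closes (slack-sound dis slack) T d≢s sd pd qd
closes-sound (diamond u a b c) dis (D , slack) = diamond-closes (slack-sound dis slack) D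
closes-sound (threat u a b c x) dis (D , x≢ , ux , t , slack) =
  threat-closes (slack-sound (disjoint-reply dis (proj₁ (proj₂ t))) slack) D x≢ ux t

-- After `play e plans`, each reply has to be met by one of the plans.
data Plan : Set where
  play  : Edge → List Plan → Plan
  close : Edge → Closing → Plan

mutual
  -- A plan whose first edge is already taken fails, so one list of alternatives can serve all
  -- replies.
  check : Plan → List Edge → List Edge → Bool
  check (play e plans) A B = ⌊ open? A B e ⌋ ∧
    all (λ r → checkSome plans (e ∷ A) (r ∷ B)) (filter (open? (e ∷ A) B) (replies (e ∷ A) B))
  check (close e c) A B = ⌊ open? A B e ×-dec closes? c (e ∷ A) B ⌋

  checkSome : List Plan → List Edge → List Edge → Bool
  checkSome [] A B = false
  checkSome (plan ∷ plans) A B = check plan A B ∨ checkSome plans A B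

mutual
  check-sound : ∀ plan {A B} → Disjoint A B → T (check plan A B) → Wins A B
  check-sound (play e plans) {A} {B} dis ok with Equivalence.to (T-∧ {⌊ open? A B e ⌋}) ok
  ... | ok₁ , next = move e o (all-replies (All.tabulate λ r∈ o′ →
    checkSome-sound plans (disjoint-reply (disjoint-claim dis (proj₂ (proj₂ o))) (proj₁ (proj₂ o′)))
      (All.lookup (all⁺ (λ r → checkSome plans (e ∷ A) (r ∷ B)) _ next) (∈-filter⁺ (open? (e ∷ A) B) r∈ o′))))
    where
    o : Open A B e
    o = toWitness {a? = open? A B e} ok₁
  check-sound (close e c) {A} {B} dis ok with toWitness {a? = open? A B e ×-dec closes? c (e ∷ A) B} ok
  ... | o , closed = move e o (closes-sound c (disjoint-claim dis (proj₂ (proj₂ o))) closed)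

  checkSome-sound : ∀ plans {A B} → Disjoint A B → T (checkSome plans A B) → Wins A B
  checkSome-sound (plan ∷ plans) {A} {B} dis ok with Equivalence.to (T-∨ {check plan A B}) ok
  ... | inj₁ ok′ = check-sound plan dis ok′
  ... | inj₂ ok′ = checkSome-sound plans dis ok′

-- The star is centred at 1 in `at1` and at 0 in `at0`. A triangle on the third move passes by the
-- edge count alone, as 4 + 2 = 6, so the star grows further only when that leaf edge is taken. The
-- `leafEdge` plans join leaf 4 to another leaf and then look for a diamond.
opening at0 at1 leafEdge34 leafEdge24 leafEdge14 : Plan
opening = play (0 , 1) (at1 ∷ at0 ∷ [])
at1 = play (1 , 2) (close (0 , 2) (triangle 0 1 2) ∷
  play (1 , 3) (close (0 , 3) (triangle 0 1 3) ∷ close (2 , 3) (triangle 1 2 3) ∷ []) ∷ [])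
at0 = play (0 , 2) (close (1 , 2) (triangle 0 1 2) ∷
  play (0 , 3) (close (1 , 3) (triangle 0 1 3) ∷ close (2 , 3) (triangle 0 2 3) ∷
    play (0 , 4) (close (2 , 3) (kite 0 2 3 4) ∷ close (1 , 3) (kite 0 1 3 4) ∷
      leafEdge34 ∷ leafEdge24 ∷ leafEdge14 ∷ []) ∷ []) ∷ [])
leafEdge34 = play (3 , 4)
  (close (1 , 4) (threat 0 4 3 1 2) ∷ close (2 , 3) (threat 0 3 4 2 1) ∷ close (2 , 4) (diamond 0 4 3 2) ∷
   close (1 , 4) (diamond 0 4 3 1) ∷ close (2 , 3) (diamond 0 3 4 2) ∷ close (1 , 3) (diamond 0 3 4 1) ∷ [])
leafEdge24 = play (2 , 4)
  (close (1 , 4) (diamond 0 4 2 1) ∷ close (1 , 4) (threat 0 4 2 1 3) ∷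
   close (3 , 4) (diamond 0 4 2 3) ∷ close (2 , 3) (diamond 0 2 4 3) ∷ [])
leafEdge14 = play (1 , 4)
  (close (2 , 4) (diamond 0 4 1 2) ∷ close (2 , 4) (threat 0 4 1 2 3) ∷
   close (3 , 4) (diamond 0 4 1 3) ∷ close (1 , 3) (diamond 0 1 4 3) ∷ [])

-- Books as copies of the target graph.

lookup-injective : ∀ {xs : List ℕ} → Unique xs → ∀ {i j} → lookup xs i ≡ lookup xs j → i ≡ j
lookup-injective (_ ∷ _) {fzero} {fzero} _ = refl
lookup-injective {_ ∷ xs} (x≢ ∷ _) {fzero} {fsuc j} eq = contradiction eq (All.lookup x≢ (∈-lookup {xs = xs} j))
lookup-injective {_ ∷ xs} (x≢ ∷ _) {fsuc i} {fzero} eq = contradiction (sym eq) (All.lookup x≢ (∈-lookup {xs = xs} i))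
lookup-injective (_ ∷ un) {fsuc i} {fsuc j} eq = cong fsuc (lookup-injective un eq)

-- The edge list of `K̂2 3` runs in the same order as `bookEdges`, so the two match entry by entry.
Book⇒Copy : ∀ {S u a x y z} → Book S u a x y z → ContainsCopy S (K̂2 3)
Book⇒Copy {u = u} {a} {x} {y} {z} (un , (ua ∷ ux ∷ ax ∷ uy ∷ ay ∷ uz ∷ az ∷ [])) =
  lookup (u ∷ a ∷ x ∷ y ∷ z ∷ []) , lookup-injective un ,
  (∈ᵤ⇒Claimed ua ∷ ∈ᵤ⇒Claimed ux ∷ ∈ᵤ⇒Claimed ax ∷ ∈ᵤ⇒Claimed uy ∷ ∈ᵤ⇒Claimed ay ∷
   ∈ᵤ⇒Claimed uz ∷ ∈ᵤ⇒Claimed az ∷ [])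

Bookless⇒¬Copy : ∀ {S} → Bookless S → ¬ ContainsCopy S (K̂2 3)
Bookless⇒¬Copy bookless (f , injective , (ua ∷ ux ∷ ax ∷ uy ∷ ay ∷ uz ∷ az ∷ [])) = bookless
  (Unique-map⁺ {f = f} injective (from-yes (unique? _≟ᶠ_ (allFin 5))) ,
  (Claimed⇒∈ᵤ ua ∷ Claimed⇒∈ᵤ ux ∷ Claimed⇒∈ᵤ ax ∷ Claimed⇒∈ᵤ uy ∷ Claimed⇒∈ᵤ ay ∷
   Claimed⇒∈ᵤ uz ∷ Claimed⇒∈ᵤ az ∷ []))

-- From the winning tree to a strategy.

LegalMove : List Edge → Edge → Set
LegalMove h e = Open h [] e

LegalMove⇒Legal : ∀ {h e} → LegalMove h e → Legal h e
LegalMove⇒Legal (e≢ , e∉ , _) = e≢ , e∉ ∘ Claimed⇒∈ᵤ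

Legal⇒LegalMove : ∀ {h e} → Legal h e → LegalMove h e
Legal⇒LegalMove (e≢ , e∉) = e≢ , e∉ ∘ ∈ᵤ⇒Claimed , λ ()

-- Descends the tree two entries at a time, past the own move and along the reply. At an illegal
-- reply, or when a single entry is left, `e` is a mere default.
replay : ∀ {S₁ S₂} → Wins S₁ S₂ → List Edge → Edge
replay (win e _ _ _) _ = e
replay {S₁} {S₂} (move e _ next) (_ ∷ r ∷ h) with open? (e ∷ S₁) S₂ r
... | yes o = replay (next r o) h
... | no _ = e
replay (move e _ _) _ = e

legalise : ∀ h e → Dec (LegalMove h e) → Edge
legalise h e (yes _) = e
legalise h e (no _) = bound h , suc (bound h)

legalise-legal : ∀ h e d → Legal h (legalise h e d)
legalise-legal h e (yes l) = LegalMove⇒Legal l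
legalise-legal h e (no _) = <⇒≢ (n<1+n (bound h)) , untouched-bound h (n≤1+n (bound h)) ∘ Claimed⇒∈ᵤ

legalise-id : ∀ {h e} d → LegalMove h e → legalise h e d ≡ e
legalise-id (yes _) _ = refl
legalise-id (no ¬l) l = contradiction l ¬l

mutual
  ∈-evens⊎odds : ∀ {e} h → e ∈ᵤ h → e ∈ᵤ P1edges h ⊎ e ∈ᵤ P2edges h
  ∈-evens⊎odds (x ∷ h) (here s) = inj₁ (here s)
  ∈-evens⊎odds (x ∷ h) (there p) = [ inj₂ , inj₁ ∘ there ]′ (∈-evens⊎odds h p)

  evens⊆ : ∀ {e} h → e ∈ᵤ P1edges h → e ∈ᵤ h
  evens⊆ (x ∷ h) (here s) = here s
  evens⊆ (x ∷ h) (there p) = there (odds⊆ h p)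

  odds⊆ : ∀ {e} h → e ∈ᵤ P2edges h → e ∈ᵤ h
  odds⊆ (x ∷ h) p = there (evens⊆ h p)

module Strategy (start : Wins [] []) where

  σ : Strategy
  σ h = legalise h (replay start h) (open? h [] (replay start h))

  σ-legal : LegalStrategy σ
  σ-legal h = legalise-legal h (replay start h) (open? h [] (replay start h))

  -- The quantification over continuations records that h has even length.
  record Reached {S₁ S₂} (w : Wins S₁ S₂) (h : List Edge) : Set where
    field
      replayed : ∀ rest → replay start (h ++ rest) ≡ replay w rest
      owned₁   : ∀ rest → P1edges (h ++ rest) ↭ S₁ ++ P1edges rest
      owned₂   : ∀ rest → P2edges (h ++ rest) ↭ S₂ ++ P2edges rest

  module _ {S₁ S₂ h} {w : Wins S₁ S₂} (reached : Reached w h) where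
    open Reached reached

    private
      edges₁ : P1edges h ↭ S₁
      edges₁ = subst (λ h′ → P1edges h′ ↭ S₁) (++-identityʳ h) (↭-trans (owned₁ []) (↭-reflexive (++-identityʳ S₁)))

      edges₂ : P2edges h ↭ S₂
      edges₂ = subst (λ h′ → P2edges h′ ↭ S₂) (++-identityʳ h) (↭-trans (owned₂ []) (↭-reflexive (++-identityʳ S₂)))

    open⇒legal : ∀ {e} → Open S₁ S₂ e → LegalMove h e
    open⇒legal (e≢ , e∉₁ , e∉₂) =
      e≢ , [ e∉₁ ∘ Any-resp-↭ edges₁ , e∉₂ ∘ Any-resp-↭ edges₂ ]′ ∘ ∈-evens⊎odds h , λ ()

    σ-follows : Open S₁ S₂ (replay w []) → σ h ≡ replay w []
    σ-follows o with replay start h | trans (cong (replay start) (sym (++-identityʳ h))) (replayed [])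
    ... | _ | refl = legalise-id (open? h [] (replay w [])) (open⇒legal o)

    legal⇒open : ∀ {e r} → LegalMove (h ++ [ e ]) r → Open (e ∷ S₁) S₂ r
    legal⇒open {e} (r≢ , r∉ , _) = r≢ ,
      (λ { (here s) → r∉ (++⁺ʳ h (here s))
         ; (there p) → r∉ (++⁺ˡ (evens⊆ h (Any-resp-↭ (↭-sym edges₁) p))) }) ,
      (λ p → r∉ (++⁺ˡ (odds⊆ h (Any-resp-↭ (↭-sym edges₂) p))))

    copy₁ : ∀ {e u a x y z} → Book (e ∷ S₁) u a x y z → ContainsCopy (P1edges (h ++ [ e ])) (K̂2 3)
    copy₁ book = Book⇒Copy (Pages-map (Any-resp-↭ (↭-sym (↭-trans (owned₁ _)
      (↭-trans (shift _ S₁ []) (↭-reflexive (cong (_ ∷_) (++-identityʳ S₁))))))) book)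

    ¬copy₂ : Bookless S₂ → ¬ ContainsCopy (P2edges h) (K̂2 3)
    ¬copy₂ bookless = Bookless⇒¬Copy (bookless ∘ Pages-map (Any-resp-↭ edges₂))

  -- Structural recursion on `w`: each round passes to the subtree of the actual reply, so a `win`
  -- node is reached after finitely many rounds.
  follow : ∀ {S₁ S₂} τ → LegalStrategy τ → (w : Wins S₁ S₂) → ∀ k → Reached w (history σ τ k) → P1Wins (K̂2 3) σ τ
  follow τ legal (win e o book bookless) k reached = k ,
    subst (λ e → ContainsCopy (P1edges (history σ τ k ++ [ e ])) (K̂2 3)) (sym (σ-follows reached o))
      (copy₁ reached book) ,
    ¬copy₂ reached bookless
  follow {S₁} {S₂} τ legal w@(move e o next) k reached
    -- The equation is kept for `step`, where `replay` branches on the same decision.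
    with open? (e ∷ S₁) S₂ (τ (history σ τ k ++ [ e ])) in eq
  ... | no ¬o = contradiction (legal⇒open reached (Legal⇒LegalMove (legal (history σ τ k ++ [ e ])))) ¬o
  ... | yes o′ = follow τ legal (next r o′) (suc k) record
    { replayed = λ rest → trans (cong (replay start) (next-history rest)) (trans (replayed _) (step rest))
    ; owned₁ = λ rest → ↭-trans (↭-reflexive (cong P1edges (next-history rest))) (↭-trans (owned₁ _) (shift e S₁ _))
    ; owned₂ = λ rest → ↭-trans (↭-reflexive (cong P2edges (next-history rest))) (↭-trans (owned₂ _) (shift r S₂ _))
    }
    where
    open Reached reached
    h = history σ τ k
    r = τ (h ++ [ e ])
    next-history : ∀ rest → history σ τ (suc k) ++ rest ≡ h ++ e ∷ r ∷ rest
    next-history rest rewrite σ-follows reached o =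
      trans (++-assoc (h ++ [ e ]) [ r ] rest) (++-assoc h [ e ] (r ∷ rest))
    step : ∀ rest → replay w (e ∷ r ∷ rest) ≡ replay (next r o′) rest
    step rest rewrite eq = refl

  winning : P1HasWinningStrategy (K̂2 3)
  winning = σ , σ-legal , λ τ legal → follow τ legal start 0 record
    { replayed = λ _ → refl ; owned₁ = λ _ → ↭-refl ; owned₂ = λ _ → ↭-refl }

plan⇒winning : ∀ plan → check plan [] [] ≡ true → P1HasWinningStrategy (K̂2 3)
plan⇒winning plan ok = Strategy.winning (check-sound plan (λ ()) (Equivalence.from T-≡ ok))

theorem3p1 : P1HasWinningStrategy (K̂2 3)
-- Type checking this `refl` evaluates `check` on the whole opening.
theorem3p1 = plan⇒winning opening refl
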